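{- $k(4) = 60$. That is, there exists a distinct covering system all of whose moduli lie in $[4,60]$, and there is no distinct covering system all of whose moduli lie in $[4,59]$.
   Context: A covering system (covering) is a finite set of congruences $\{x \equiv r_i \pmod{n_i}\}$ with positive integer moduli such that every integer satisfies at least one of them. A covering is distinct if the moduli are pairwise distinct and all greater than $1$. For an integer $n\ge 2$, $k(n)$ denotes the least positive integer such that there exists a distinct covering system with all moduli in the interval $[n, k(n)]$. -}

module Defs where

open import Data.Nat using (ℕ; _≤_; _<_)
open import Data.Integer using (ℤ; +_; _-_)
open import Data.Integer.Divisibility using (_∣_)
open import Data.Product using (_×_; proj₁; proj₂; ∃-syntax)
open import Data.List using (List; map)
open import Data.List.Membership.Propositional using (_∈_)
open import Data.List.Relation.Unary.All using (All)
open import Data.List.Relation.Unary.Unique.Propositional using (Unique)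

Congruence : Set
Congruence = ℤ × ℕ

residue : Congruence → ℤ
residue = proj₁

modulus : Congruence → ℕ
modulus = proj₂

Satisfies : ℤ → Congruence → Set
Satisfies x c = (+ modulus c) ∣ (x - residue c)

IsCovering : List Congruence → Set
IsCovering cs = ∀ (x : ℤ) → ∃[ c ] (c ∈ cs × Satisfies x c)

IsDistinctCovering : List Congruence → Set
IsDistinctCovering cs =
  IsCovering cs × Unique (map modulus cs) × All (λ c → 1 < modulus c) cs

ModuliIn : ℕ → ℕ → List Congruence → Set
ModuliIn a b cs = All (λ c → a ≤ modulus c × modulus c ≤ b) cs

HasDistinctCoveringIn : ℕ → ℕ → Set
HasDistinctCoveringIn a b = ∃[ cs ] (IsDistinctCovering cs × ModuliIn a b cs)

{-# OPTIONS --safe #-}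
module Submission where

-- Lower bound. Suppose residues ρ n for 4 ≤ n ≤ 59 give a covering, and let N be a period of it and p a
-- prime dividing N. If x is missed by all moduli dividing N/p, the p translates x + j·N/p are missed by
-- them too, and lie in distinct classes modulo each other modulus; so at least p of the other moduli
-- exist, and if there are exactly p of them, all are used and x lies in each of their classes modulo n/p.
-- Moduli not dividing 5040 are thereby useless, the seven multiples of 7 can be replaced by one class
-- modulo 120, and then 16 and 48 by one class modulo 24. Now all moduli divide 360. Let R be the set of
-- y modulo 72 missed by the nine moduli prime to 5. Each of the five fibres R × {j} of ℤ/72 × ℤ/5 is
-- covered by the moduli 5b, b ∈ {1,2,3,4,6,8,9,24}, lying over j; some fibre has at most one of them and
-- not b = 1, so R lies in one class modulo 2 or 3. Thus the moduli prime to 5 cover everything outside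
-- that class, and too few of them remain for what is left; a short search with a counting bound rules
-- this out.

open import Defs
open import Data.Bool using (Bool; true; false; T; _∨_; if_then_else_)
open import Data.Bool.ListAction using (all)
open import Data.Bool.Properties using (T-∨)
open import Data.Empty using (⊥)
open import Data.Fin using (Fin; toℕ)
open import Data.Fin.Properties using (pigeonhole; toℕ<n)
open import Data.Integer using (ℤ; +_; _%ℕ_; _/ℕ_; 0ℤ)
import Data.Integer as ℤ
import Data.Integer.Divisibility.Signed as ℤ
open import Data.Integer.DivMod using (n%ℕd<d; a≡a%ℕn+[a/ℕn]*n)
import Data.Integer.Properties as ℤ
open import Data.Integer.Tactic.RingSolver using () renaming (solve-∀ to solveℤ)
open import Data.List using (List; []; _∷_; _++_; map; filter; foldr; length; upTo; applyUpTo)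
import Data.List as List
import Data.List.Properties as List
open import Data.List.Membership.Propositional using (_∈_; find; lose)
open import Data.List.Membership.Propositional.Properties using (∈-filter⁺; ∈-filter⁻; ∈-lookup; ∈-map⁺)
open import Data.List.Membership.Propositional.Properties using (∈-++⁺ˡ; ∈-++⁺ʳ; ∈-upTo⁺; ∈-applyUpTo⁺)
open import Data.List.Properties using (filter-accept; filter-notAll; map-++)
open import Data.List.Relation.Unary.All using (All; []; _∷_)
import Data.List.Relation.Unary.All as All
open import Data.List.Relation.Unary.All.Properties using (all⁺; ¬All⇒Any¬)
import Data.List.Relation.Unary.All.Properties as All
open import Data.List.Relation.Unary.AllPairs using (_∷_)
open import Data.List.Relation.Unary.Any using (Any; here; there)
import Data.List.Relation.Unary.Any as Any
import Data.List.Relation.Unary.Any.Properties as Any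
open import Data.List.Relation.Unary.Unique.Propositional using (Unique)
open import Data.Nat
open import Data.Nat.DivMod using (_%_; _/_; m%n<n; m<n⇒m%n≡m; m∣n⇒o%n%m≡o%m)
open import Data.Nat.Divisibility using (_∣_; _∣?_; divides; ∣-refl; ∣n⇒∣m*n; ∣m⇒∣m*n; >⇒∤)
open import Data.Nat.ListAction using (sum; product)
open import Data.Nat.ListAction.Properties using (sum-++)
open import Data.Nat.Properties
open import Data.List.Relation.Unary.Unique.DecPropositional _≟_ using (unique?)
open import Data.Nat.Tactic.RingSolver using (solve-∀)
open import Data.Product using (_×_; _,_; proj₁; proj₂; ∃-syntax; map₁; map₂)
open import Data.Product.Properties using (≡-dec)
open import Data.List.Membership.DecPropositional (≡-dec _≟_ _≟_) using (_∈?_)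
open import Data.Sum using (_⊎_; inj₁; inj₂; [_,_]′)
import Data.Sum as Sum
open import Data.Unit using (⊤; tt)
open import Function using (_∘_; Equivalence)
open import Relation.Binary.PropositionalEquality
open import Relation.Nullary using (¬_; Dec; ¬?; yes; no; does; contradiction; _×-dec_)
open import Relation.Nullary.Decidable using (from-yes; toWitness)

-- Congruences

pos-∣ : ∀ {m n} → m ∣ n → + m ℤ.∣ + n
pos-∣ = ℤ.∣ᵤ⇒∣

∣-combine : ∀ {k a b c} → k ℤ.∣ a → k ℤ.∣ b → a ℤ.+ b ≡ c → k ℤ.∣ c
∣-combine k∣a k∣b refl = ℤ.∣m∣n⇒∣m+n k∣a k∣b

%ℕ-cong : ∀ d .{{_ : NonZero d}} x y → + d ℤ.∣ x ℤ.- y → x %ℕ d ≡ y %ℕ d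
%ℕ-cong d x y d∣x-y = close (n%ℕd<d x d) (n%ℕd<d y d)
  (∣-combine d∣x-y (ℤ.∣n⇒∣m*n (y /ℕ d ℤ.- x /ℕ d) ℤ.∣-refl)
    (trans (cong₂ (λ u v → u ℤ.- v ℤ.+ (y /ℕ d ℤ.- x /ℕ d) ℤ.* + d)
                  (a≡a%ℕn+[a/ℕn]*n x d) (a≡a%ℕn+[a/ℕn]*n y d))
           (cancel (+ (x %ℕ d)) (+ (y %ℕ d)) (x /ℕ d) (y /ℕ d) (+ d))))
  where
  cancel : ∀ a b u v d → a ℤ.+ u ℤ.* d ℤ.- (b ℤ.+ v ℤ.* d) ℤ.+ (v ℤ.- u) ℤ.* d ≡ a ℤ.- b
  cancel = solveℤ

  below : ∀ {a b} → a ≤ b → b < d → d ∣ b ∸ a → a ≡ b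
  below {a} {b} a≤b b<d d∣b-a with b ∸ a in eq
  ... | zero  = ≤-antisym a≤b (m∸n≡0⇒m≤n eq)
  ... | suc n = contradiction d∣b-a (>⇒∤ (≤-<-trans (≤-trans (≤-reflexive (sym eq)) (m∸n≤m b a)) b<d))

  close : ∀ {a b} → a < d → b < d → + d ℤ.∣ + a ℤ.- + b → a ≡ b
  close {a} {b} a<d b<d d∣ with ≤-total a b | subst (d ∣_) (cong ℤ.∣_∣ (ℤ.m-n≡m⊖n a b)) (ℤ.∣⇒∣ᵤ d∣)
  ... | inj₁ a≤b | d∣a⊖b = below a≤b b<d (subst (d ∣_) (ℤ.∣⊖∣-≤ a≤b) d∣a⊖b)
  ... | inj₂ b≤a | d∣a⊖b = sym (below b≤a a<d (subst (d ∣_) (trans (ℤ.∣m⊖n∣≡∣n⊖m∣ a b) (ℤ.∣⊖∣-≤ b≤a)) d∣a⊖b))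

-- A distinct covering with moduli in [4,60]

-- Found by running the lower bound argument backwards: 16 and 48 together cover 20 (mod 24), and the
-- seven multiples of 7 together cover 117 (mod 120).
witness : List Congruence
witness =
    (+ 2 , 4) ∷ (+ 0 , 5) ∷ (+ 1 , 6) ∷ (+ 0 , 7) ∷ (+ 0 , 8) ∷ (+ 0 , 9) ∷ (+ 1 , 10) ∷ (+ 4 , 12) ∷ (+ 1 , 14)
  ∷ (+ 2 , 15) ∷ (+ 4 , 16) ∷ (+ 3 , 18) ∷ (+ 13 , 20) ∷ (+ 9 , 21) ∷ (+ 12 , 24) ∷ (+ 17 , 28) ∷ (+ 29 , 30)
  ∷ (+ 32 , 35) ∷ (+ 15 , 36) ∷ (+ 17 , 40) ∷ (+ 33 , 42) ∷ (+ 24 , 45) ∷ (+ 44 , 48) ∷ (+ 13 , 56) ∷ (+ 23 , 60)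
  ∷ []

satisfies? : ∀ x c → Dec (Satisfies x c)
satisfies? x c = modulus c ∣? ℤ.∣ x ℤ.- residue c ∣

witness-covers-period : All (λ r → Any (Satisfies (+ r)) witness) (upTo 5040)
witness-covers-period = toWitness {a? = All.all? (λ r → Any.any? (satisfies? (+ r)) witness) (upTo 5040)} _

witness-divides-period : All (λ c → modulus c ∣ 5040) witness
witness-divides-period = from-yes (All.all? (λ c → modulus c ∣? 5040) witness)

satisfies-periodic : ∀ N .{{_ : NonZero N}} x c → modulus c ∣ N → Satisfies (+ (x %ℕ N)) c → Satisfies x c
satisfies-periodic N x c m∣N sat = ℤ.∣⇒∣ᵤ (∣-combine (ℤ.∣ᵤ⇒∣ {i = + (x %ℕ N) ℤ.- residue c} sat)
  (ℤ.∣n⇒∣m*n (x /ℕ N) (pos-∣ m∣N))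
  (trans (regroup (+ (x %ℕ N)) (residue c) (x /ℕ N ℤ.* + N)) (cong (ℤ._- residue c) (sym (a≡a%ℕn+[a/ℕn]*n x N)))))
  where
  regroup : ∀ a r b → a ℤ.- r ℤ.+ b ≡ a ℤ.+ b ℤ.- r
  regroup = solveℤ

covering-from-period : ∀ {cs} N .{{_ : NonZero N}} → All (λ c → modulus c ∣ N) cs →
  All (λ r → Any (Satisfies (+ r)) cs) (upTo N) → IsCovering cs
covering-from-period N divide cov x with find (All.lookup cov (∈-upTo⁺ (n%ℕd<d x N)))
... | c , c∈ , sat = c , c∈ , satisfies-periodic N x c (All.lookup divide c∈) sat

distinct-covering-in-4-60 : HasDistinctCoveringIn 4 60
distinct-covering-in-4-60 = witness
  , ( covering-from-period 5040 witness-divides-period witness-covers-period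
    , from-yes (unique? (map modulus witness))
    , from-yes (All.all? (λ c → 1 <? modulus c) witness))
  , from-yes (All.all? (λ c → (4 ≤? modulus c) ×-dec (modulus c ≤? 60)) witness)

-- The search

-- The key (n , m) stands for the class of ρ n modulo m, where ρ n is the residue given to the modulus n.
Key : Set
Key = ℕ × ℕ

-- A modulus 0 is read as 1.
period : Key → ℕ
period k = suc (pred (proj₂ k))

sift : Key → ℕ → List ℕ → List ℕ
sift k r = filter (λ y → ¬? (y % period k ≟ r))

tally : ℕ → List ℕ → ℕ
tally r rs = length (filter (r ≟_) rs)

peakBelow : ℕ → List ℕ → ℕ
peakBelow m rs = foldr _⊔_ 0 (map (λ r → tally r rs) (upTo m))

peak : List ℕ → Key → ℕ
peak U k = peakBelow (period k) (map (_% period k) U)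

picks : List Key → List (Key × List Key)
picks []      = []
picks (k ∷ L) = (k , L) ∷ map (map₂ (k ∷_)) (picks L)

-- The classes with q ∣ m lie on one side of "≡ c (mod q)"; the other classes may meet both sides.
splits : (q : ℕ) → List Key → List (List Key × List Key)
splits q []      = ([] , []) ∷ []
splits q (k ∷ L) with q ∣? period k
... | yes _ = map (map₁ (k ∷_)) (splits q L) ++ map (map₂ (k ∷_)) (splits q L)
... | no  _ = map (λ (S , S′) → k ∷ S , k ∷ S′) (splits q L)

-- After a translation the classes of pinned are 0 (mod 8) and 0 (mod 9). An entry (n , b) of fivefold
-- is the trace on ℤ/72 of a class modulo 5b.
pinned free fivefold : List Key
pinned   = (8 , 8) ∷ (9 , 9) ∷ []
free     = (4 , 4) ∷ (6 , 6) ∷ (12 , 12) ∷ (18 , 18) ∷ (24 , 24) ∷ (48 , 24) ∷ (36 , 36) ∷ []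
fivefold = (5 , 1) ∷ (10 , 2) ∷ (15 , 3) ∷ (20 , 4) ∷ (30 , 6) ∷ (40 , 8) ∷ (45 , 9) ∷ (120 , 24) ∷ []

-- Over the five fibres a class of L counts five times, a class of fivefold once.
overfull : List Key → List ℕ → Bool
overfull L U = 5 * sum (map (peak U) L) + sum (map (peak U) fivefold) <ᵇ 5 * length U

refuted : List Key → List ℕ → Bool
refuted []      U = overfull [] U
refuted (k ∷ L) U = overfull (k ∷ L) U ∨ all (λ r → refuted L (sift k r U)) (upTo (period k))

-- The first point left must lie in some class of `L`, and this fixes the residue of that class, so
-- the branching is over classes instead of residues. The fuel 8 used below exceeds the seven
-- classes of `free`.
uncoverable : ℕ → List Key → List ℕ → Bool
uncoverable _       L []      = false
uncoverable zero    L (x ∷ U) = false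
uncoverable (suc f) L (x ∷ U) =
  all (λ (k , L′) → uncoverable f L′ (sift k (x % period k) U)) (picks L)

-- Multiples of 3 are listed twice: with equal weights the bound in overfull just fails when the missed
-- set consists of a full class modulo 6 and two multiples of 3.
points : List ℕ
points = sift (8 , 8) 0 (sift (9 , 9) 0 (upTo 72 ++ applyUpTo (3 *_) 24))

module _ (q : ℕ) .{{_ : NonZero q}} (c : ℕ) where

  inside outside : List ℕ
  inside  = filter (λ y → y % q ≟ c) points
  outside = filter (λ y → ¬? (y % q ≟ c)) points

  -- For each split one of two contradictions is sought: `S` alone cannot cover the points outside
  -- the class, or `L` cannot cover those inside even with the help of `fivefold`.
  impossible : Bool
  impossible = all (λ (S , L) → uncoverable 8 S outside ∨ refuted L inside) (splits q free)

-- A record, so that comparing two of its instances does not run the search.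
record Impossible (q : ℕ) .{{_ : NonZero q}} (c : ℕ) : Set where
  constructor checked
  field verdict : T (impossible q c)

impossible₂ : ∀ c → c < 2 → Impossible 2 c
impossible₂ 0 _ = checked _
impossible₂ 1 _ = checked _
impossible₂ (suc (suc _)) (s≤s (s≤s ()))

impossible₃ : ∀ c → c < 3 → Impossible 3 c
impossible₃ 0 _ = checked _
impossible₃ 1 _ = checked _
impossible₃ 2 _ = checked _
impossible₃ (suc (suc (suc _))) (s≤s (s≤s (s≤s ())))

-- Soundness of the search

all-∈ : ∀ {A : Set} (p : A → Bool) {xs x} → T (all p xs) → x ∈ xs → T (p x)
all-∈ p {xs} t = All.lookup (all⁺ p xs t)

≤-maximum : ∀ {x xs} → x ∈ xs → x ≤ foldr _⊔_ 0 xs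
≤-maximum {x} (here refl)          = m≤m⊔n x _
≤-maximum {x} {y ∷ xs} (there x∈xs) = ≤-trans (≤-maximum x∈xs) (m≤n⊔m y _)

tally≤peak : ∀ U k {r} → r < period k → tally r (map (_% period k) U) ≤ peak U k
tally≤peak U k r<m = ≤-maximum (∈-map⁺ (λ r → tally r (map (_% period k) U)) (∈-upTo⁺ r<m))

tally-∷ : ∀ r s rs → tally r rs ≤ tally r (s ∷ rs)
tally-∷ r s rs with does (r ≟ s)
... | true  = n≤1+n _
... | false = ≤-refl

tally-hit : ∀ {r s} rs → s ≡ r → suc (tally r rs) ≤ tally r (s ∷ rs)
tally-hit {r} rs refl = ≤-reflexive (sym (cong length (filter-accept (r ≟_) {r} {rs} refl)))

share : ℕ → ℕ → ℕ → ℕ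
share f j v = if f ≡ᵇ j then v else 0

share-total : ∀ f v → share f 0 v + (share f 1 v + (share f 2 v + (share f 3 v + share f 4 v))) ≤ v
share-total 0 v = ≤-reflexive (+-identityʳ v)
share-total 1 v = ≤-reflexive (+-identityʳ v)
share-total 2 v = ≤-reflexive (+-identityʳ v)
share-total 3 v = ≤-reflexive (+-identityʳ v)
share-total 4 v = ≤-refl
share-total (suc (suc (suc (suc (suc f))))) v = z≤n

-- `φ k` is the fibre over which an entry `k` of `fivefold` lies.
module Residues (σ : Key → ℕ) (σ< : ∀ k → σ k < period k) (φ : Key → ℕ) where

  Hits : ℕ → Key → Set
  Hits y k = y % period k ≡ σ k

  group : ℕ → List Key → List Key
  group j = filter (λ k → φ k ≟ j)

  load : (Key → ℕ) → ℕ → List Key → ℕ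
  load w j G = sum (map w (group j G))

  load-∷ : ∀ w j k G → load w j (k ∷ G) ≡ share (φ k) j (w k) + load w j G
  load-∷ w j k G with φ k ≡ᵇ j
  ... | true  = refl
  ... | false = refl

  loads : ∀ w G → load w 0 G + (load w 1 G + (load w 2 G + (load w 3 G + load w 4 G))) ≤ sum (map w G)
  loads w []      = z≤n
  loads w (k ∷ G)
    rewrite load-∷ w 0 k G | load-∷ w 1 k G | load-∷ w 2 k G | load-∷ w 3 k G | load-∷ w 4 k G
    = ≤-trans (≤-reflexive (interchange (s 0) (s 1) (s 2) (s 3) (s 4) _ _ _ _ _))
              (+-mono-≤ (share-total (φ k) (w k)) (loads w G))
    where
    s : ℕ → ℕ
    s j = share (φ k) j (w k)

    interchange : ∀ a b c d e a′ b′ c′ d′ e′ →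
      (a + a′) + ((b + b′) + ((c + c′) + ((d + d′) + (e + e′)))) ≡
      (a + (b + (c + (d + e)))) + (a′ + (b′ + (c′ + (d′ + e′))))
    interchange = solve-∀

  -- Summed over the five fibres, `a` counts five times, but each member of `G` at most once.
  fibre-sum : ∀ w a c G → (∀ j → j < 5 → c ≤ a + load w j G) → 5 * c ≤ 5 * a + sum (map w G)
  fibre-sum w a c G h = begin
    5 * c  ≤⟨ +-mono-≤ (h 0 (s≤s z≤n)) (+-mono-≤ (h 1 (s≤s (s≤s z≤n))) (+-mono-≤ (h 2 (s≤s (s≤s (s≤s z≤n))))
              (+-mono-≤ (h 3 (s≤s (s≤s (s≤s (s≤s z≤n))))) (+-monoˡ-≤ 0 (h 4 ≤-refl))))) ⟩
    _      ≡⟨ regroup a (load w 0 G) (load w 1 G) (load w 2 G) (load w 3 G) (load w 4 G) ⟩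
    5 * a + (load w 0 G + (load w 1 G + (load w 2 G + (load w 3 G + load w 4 G))))
           ≤⟨ +-monoʳ-≤ (5 * a) (loads w G) ⟩
    5 * a + sum (map w G) ∎
    where
    open ≤-Reasoning
    regroup : ∀ a b c d e f →
      (a + b) + ((a + c) + ((a + d) + ((a + e) + ((a + f) + 0)))) ≡ 5 * a + (b + (c + (d + (e + f))))
    regroup = solve-∀

  tallies : List ℕ → List Key → ℕ
  tallies U G = sum (map (λ k → tally (σ k) (map (_% period k) U)) G)

  tallies-∷ : ∀ u U G → tallies U G ≤ tallies (u ∷ U) G
  tallies-∷ u U []      = z≤n
  tallies-∷ u U (k ∷ G) = +-mono-≤ (tally-∷ (σ k) (u % period k) _) (tallies-∷ u U G)

  tallies-hit : ∀ {u} U {G} → Any (Hits u) G → suc (tallies U G) ≤ tallies (u ∷ U) G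
  tallies-hit {u} U {k ∷ G} (here hit)  = +-mono-≤ (tally-hit _ hit) (tallies-∷ u U G)
  tallies-hit {u} U {k ∷ G} (there hit) =
    ≤-trans (≤-reflexive (sym (+-suc _ _))) (+-mono-≤ (tally-∷ (σ k) (u % period k) _) (tallies-hit {u} U hit))

  length≤tallies : ∀ U G → (∀ {u} → u ∈ U → Any (Hits u) G) → length U ≤ tallies U G
  length≤tallies []      G h = z≤n
  length≤tallies (u ∷ U) G h = ≤-trans (s≤s (length≤tallies U G (h ∘ there))) (tallies-hit {u} U (h (here refl)))

  tallies≤peaks : ∀ U G → tallies U G ≤ sum (map (peak U) G)
  tallies≤peaks U []      = z≤n
  tallies≤peaks U (k ∷ G) = +-mono-≤ (tally≤peak U k (σ< k)) (tallies≤peaks U G)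

  -- Of the five points of ℤ/360 above `u`, a class of `L` contains all or none, an entry of
  -- `fivefold` at most the one in its own fibre.
  Fibred : List Key → List ℕ → Set
  Fibred L U = ∀ {u} → u ∈ U → ∀ j → j < 5 → Any (Hits u) L ⊎ Any (Hits u) (group j fivefold)

  overfull-sound : ∀ L U → T (overfull L U) → ¬ Fibred L U
  overfull-sound L U t h = <⇒≱ (<ᵇ⇒< _ _ t) (fibre-sum (peak U) (sum (map (peak U) L)) (length U) fivefold bound)
    where
    bound : ∀ j → j < 5 → length U ≤ sum (map (peak U) L) + load (peak U) j fivefold
    bound j j<5 = begin
      length U                                          ≤⟨ length≤tallies U G (λ u∈U → [ Any.++⁺ˡ , Any.++⁺ʳ L ]′ (h u∈U j j<5)) ⟩
      tallies U G                                       ≤⟨ tallies≤peaks U G ⟩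
      sum (map (peak U) G)                              ≡⟨ cong sum (map-++ (peak U) L _) ⟩
      sum (map (peak U) L ++ map (peak U) _)            ≡⟨ sum-++ (map (peak U) L) _ ⟩
      sum (map (peak U) L) + load (peak U) j fivefold   ∎
      where
      open ≤-Reasoning
      G = L ++ group j fivefold

  sift-∈ : ∀ k {r U u} → u ∈ sift k r U → u ∈ U × u % period k ≢ r
  sift-∈ k {r} = ∈-filter⁻ (λ y → ¬? (y % period k ≟ r))

  refuted-sound : ∀ L U → T (refuted L U) → ¬ Fibred L U
  refuted-sound []      U t h = overfull-sound [] U t h
  refuted-sound (k ∷ L) U t h with Equivalence.to T-∨ t
  ... | inj₁ full = overfull-sound (k ∷ L) U full h
  ... | inj₂ each = refuted-sound L (sift k (σ k) U) (all-∈ _ each (∈-upTo⁺ (σ< k))) λ u∈ j j<5 →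
    Sum.map₁ (Any.tail (proj₂ (sift-∈ k {U = U} u∈))) (h (proj₁ (sift-∈ k {U = U} u∈)) j j<5)

  -- The last component ensures that points missed by `k` keep a class hitting them after `k` is
  -- removed.
  picks-complete : ∀ {P : Key → Set} {L} → Any P L →
    ∃[ k ] ∃[ L′ ] ((k , L′) ∈ picks L × P k × (∀ {Q : Key → Set} → ¬ Q k → Any Q L → Any Q L′))
  picks-complete {L = k ∷ L} (here p)  = k , L , here refl , p , Any.tail
  picks-complete {L = k ∷ L} (there a) with picks-complete a
  ... | k′ , L′ , k′∈ , p , rest = k′ , k ∷ L′ , there (∈-map⁺ (map₂ (k ∷_)) k′∈) , p , λ where
    ¬q (here q)  → here q
    ¬q (there b) → there (rest ¬q b)

  uncoverable-sound : ∀ f L U → T (uncoverable f L U) → ¬ (∀ {u} → u ∈ U → Any (Hits u) L)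
  uncoverable-sound (suc f) L (x ∷ U) t h with picks-complete (h (here refl))
  ... | k , L′ , k∈ , hit , rest =
    uncoverable-sound f L′ (sift k (x % period k) U) (all-∈ _ t k∈) λ u∈ →
      rest (λ hit′ → proj₂ (sift-∈ k {U = U} u∈) (trans hit′ (sym hit))) (h (there (proj₁ (sift-∈ k {U = U} u∈))))

  hits-% : ∀ q .{{_ : NonZero q}} y k → q ∣ period k → Hits y k → y % q ≡ σ k % q
  hits-% q y k q∣m hit = trans (sym (m∣n⇒o%n%m≡o%m q (period k) y q∣m)) (cong (_% q) hit)

  module _ (q : ℕ) .{{_ : NonZero q}} (c : ℕ) where

    Splits : List Key → List Key → List Key → Set
    Splits L S S′ = (∀ {y} → y % q ≢ c → Any (Hits y) L → Any (Hits y) S)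
                  × (∀ {y} → y % q ≡ c → Any (Hits y) L → Any (Hits y) S′)

    splits-complete : ∀ L → ∃[ S ] ∃[ S′ ] ((S , S′) ∈ splits q L × Splits L S S′)
    splits-complete []      = [] , [] , here refl , (λ _ ()) , (λ _ ())
    splits-complete (k ∷ L) with splits-complete L | q ∣? period k
    ... | S , S′ , ∈L , out , ins | no _ = k ∷ S , k ∷ S′ , ∈-map⁺ _ ∈L
        , (λ { ≢c (here p) → here p ; ≢c (there a) → there (out ≢c a) })
        , (λ { ≡c (here p) → here p ; ≡c (there a) → there (ins ≡c a) })
    ... | S , S′ , ∈L , out , ins | yes q∣m with σ k % q ≟ c
    ...   | yes σ≡c = S , k ∷ S′ , ∈-++⁺ʳ (map (map₁ (k ∷_)) (splits q L)) (∈-map⁺ _ ∈L)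
        , (λ { {y} ≢c (here p) → contradiction (trans (hits-% q y k q∣m p) σ≡c) ≢c ; ≢c (there a) → out ≢c a })
        , (λ { ≡c (here p) → here p ; ≡c (there a) → there (ins ≡c a) })
    ...   | no  σ≢c = k ∷ S , S′ , ∈-++⁺ˡ (∈-map⁺ _ ∈L)
        , (λ { ≢c (here p) → here p ; ≢c (there a) → there (out ≢c a) })
        , (λ { {y} ≡c (here p) → contradiction (trans (sym (hits-% q y k q∣m p)) ≡c) σ≢c ; ≡c (there a) → ins ≡c a })

    -- For the split that the residues select, `uncoverable` contradicts the confinement to one
    -- class, and `refuted` contradicts `Fibred`.
    confined : Impossible q c → Fibred free points → ¬ (∀ {y} → y ∈ points → Any (Hits y) free ⊎ y % q ≡ c)
    confined (checked t) fib h with splits-complete free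
    ... | S , S′ , ∈splits , out , ins with Equivalence.to T-∨ (all-∈ _ t ∈splits)
    ...   | inj₁ u = uncoverable-sound 8 S (outside q c) u λ y∈ → case-out y∈
      where
      case-out : ∀ {y} → y ∈ outside q c → Any (Hits y) S
      case-out y∈ with ∈-filter⁻ (λ y → ¬? (y % q ≟ c)) {xs = points} y∈
      ... | y∈points , ≢c = [ out ≢c , (λ ≡c → contradiction ≡c ≢c) ]′ (h y∈points)
    ...   | inj₂ r = refuted-sound S′ (inside q c) r case-in
      where
      case-in : Fibred S′ (inside q c)
      case-in y∈ j j<5 with ∈-filter⁻ (λ y → y % q ≟ c) {xs = points} y∈
      ... | y∈points , ≡c = Sum.map₁ (ins ≡c) (fib y∈points j j<5)

  -- The weights of fivefold add up to 9 < 5 · 2, so some fibre has weight at most 1.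
  weight : Key → ℕ
  weight (_ , 1) = 2
  weight _       = 1

  weight-positive : ∀ k → 1 ≤ weight k
  weight-positive (_ , 0)             = ≤-refl
  weight-positive (_ , 1)             = s≤s z≤n
  weight-positive (_ , suc (suc _))   = ≤-refl

  -- Only `(5 , 1)`, which fills its whole fibre, has weight 2; every other period is a multiple of
  -- 2 or 3.
  even⊎ternary : All (λ k → weight k < 2 → 2 ∣ period k ⊎ 3 ∣ period k) fivefold
  even⊎ternary =
      (λ { (s≤s (s≤s ())) })
    ∷ (λ _ → inj₁ (divides 1 refl)) ∷ (λ _ → inj₂ (divides 1 refl)) ∷ (λ _ → inj₁ (divides 2 refl))
    ∷ (λ _ → inj₁ (divides 3 refl)) ∷ (λ _ → inj₁ (divides 4 refl)) ∷ (λ _ → inj₂ (divides 3 refl))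
    ∷ (λ _ → inj₁ (divides 12 refl)) ∷ []

  module _ (fib : Fibred free points) where

    -- Over a light fibre lies at most one entry of `fivefold`. It must contain every point missed
    -- by `free`, which confines these points to one class modulo 2 or 3.
    no-light-fibre : ∀ j → j < 5 → 2 ≤ load weight j fivefold
    no-light-fibre j j<5 = ≮⇒≥ λ light → by-size (group j fivefold) light
      (λ y∈ → fib y∈ j j<5) (λ k∈ → All.lookup even⊎ternary (proj₁ (∈-filter⁻ (λ k → φ k ≟ j) k∈)))
      where
      by-size : ∀ G → sum (map weight G) < 2 →
        (∀ {y} → y ∈ points → Any (Hits y) free ⊎ Any (Hits y) G) →
        (∀ {k} → k ∈ G → weight k < 2 → 2 ∣ period k ⊎ 3 ∣ period k) → ⊥
      -- With no entry over `j`, `free` already hits every point, so any class modulo 2 will do.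
      by-size [] _ h _ = confined 2 0 (impossible₂ 0 (s≤s z≤n)) fib (Sum.map₂ (λ ()) ∘ h)
      by-size (k ∷ []) light h d with d (here refl) (<-≤-trans (s≤s (m≤m+n (weight k) 0)) light)
      ... | inj₁ 2∣m = confined 2 (σ k % 2) (impossible₂ _ (m%n<n (σ k) 2)) fib λ {y} y∈ →
        Sum.map₂ (λ { (here hit) → hits-% 2 y k 2∣m hit }) (h y∈)
      ... | inj₂ 3∣m = confined 3 (σ k % 3) (impossible₃ _ (m%n<n (σ k) 3)) fib λ {y} y∈ →
        Sum.map₂ (λ { (here hit) → hits-% 3 y k 3∣m hit }) (h y∈)
      by-size (k ∷ k′ ∷ G) light _ _ =
        <⇒≱ light (+-mono-≤ (weight-positive k) (≤-trans (weight-positive k′) (m≤m+n _ _)))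

    not-fibred : ⊥
    not-fibred = <⇒≱ {9} {10} ≤-refl (fibre-sum weight 0 2 fivefold no-light-fibre)

-- Discarding and merging moduli

kept rest : ℕ → List Key → List Key
kept N = filter (λ k → proj₂ k ∣? N)
rest N = filter (λ k → ¬? (proj₂ k ∣? N))

-- The factors `suc i` are the differences 1, ..., p - 1 of two indices below p: no two of the p
-- translates x + j · N share a class of this modulus.
Separated : ℕ → ℕ → Key → Set
Separated p N k = ∀ {i} → i < pred p → ¬ proj₂ k ∣ suc i * N

separated? : ∀ p N k → Dec (Separated p N k)
separated? p N k = allUpTo? (λ i → ¬? (proj₂ k ∣? suc i * N)) (pred p)

Droppable : ℕ → ℕ → List Key → Set
Droppable p N L = length (rest N L) < p × All (Separated p N) (rest N L)

-- The period product (p ∷ ps) * N is divided by the primes of the list, one after the other.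
Sievable : List ℕ → ℕ → List Key → Set
Sievable []       N L = ⊤
Sievable (p ∷ ps) N L = Droppable p (product ps * N) L × Sievable ps N (kept (product ps * N) L)

sievable? : ∀ ps N L → Dec (Sievable ps N L)
sievable? []       N L = yes tt
sievable? (p ∷ ps) N L =
  ((length (rest N′ L) <? p) ×-dec All.all? (separated? p N′) (rest N′ L)) ×-dec sievable? ps N (kept N′ L)
  where N′ = product ps * N

sieve : List ℕ → ℕ → List Key → List Key
sieve []       N L = L
sieve (p ∷ ps) N L = sieve ps N (kept (product ps * N) L)

module Covering (ρ : ℕ → ℤ) where

  Hit : ℤ → Key → Set
  Hit x (n , m) = + m ℤ.∣ x ℤ.- ρ n

  hit? : ∀ x k → Dec (Hit x k)
  hit? x (n , m) = + m ℤ.∣? x ℤ.- ρ n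

  Covers : List Key → Set
  Covers L = ∀ x → Any (Hit x) L

  fibre-bound : ∀ p N {D} x → All (Separated p N) D →
    (∀ (j : Fin p) → Any (Hit (x ℤ.+ + (toℕ j * N))) D) → p ≤ length D
  fibre-bound p N {D} x sep h = ≮⇒≥ collision
    where
    collision : ¬ length D < p
    collision D<p with pigeonhole D<p (Any.index ∘ h)
    ... | i , j , i<j , same = All.lookup sep (∈-lookup (Any.index (h j))) d<p-1 (ℤ.∣⇒∣ᵤ m∣)
      where
      k = List.lookup D (Any.index (h j))
      -- One less than the difference of the indices, to match `suc i` in `Separated`.
      d = toℕ j ∸ suc (toℕ i)

      j≡ : suc (toℕ i) + d ≡ toℕ j
      j≡ = m+[n∸m]≡n i<j

      d<p-1 : d < pred p
      d<p-1 = <⇒≤pred (≤-<-trans (≤-trans (s≤s (m≤n+m d (toℕ i))) (≤-reflexive j≡)) (toℕ<n j))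

      hitᵢ : Hit (x ℤ.+ + (toℕ i * N)) k
      hitᵢ = subst (λ l → Hit (x ℤ.+ + (toℕ i * N)) (List.lookup D l)) same (Any.lookup-index (h i))

      difference : ∀ x r a b → (x ℤ.+ (a ℤ.+ b) ℤ.- r) ℤ.+ ℤ.- (x ℤ.+ a ℤ.- r) ≡ b
      difference = solveℤ

      j*N≡ : + (toℕ j * N) ≡ + (toℕ i * N) ℤ.+ + (suc d * N)
      j*N≡ = trans (cong +_ (trans (cong (_* N) (trans (sym j≡) (sym (+-suc (toℕ i) d))))
                                   (*-distribʳ-+ N (toℕ i) (suc d))))
                   (ℤ.pos-+ (toℕ i * N) (suc d * N))

      m∣ : + proj₂ k ℤ.∣ + (suc d * N)
      m∣ = ∣-combine (Any.lookup-index (h j)) (ℤ.∣m⇒∣-m hitᵢ)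
        (trans (cong (λ z → (x ℤ.+ z ℤ.- ρ (proj₁ k)) ℤ.+ ℤ.- (x ℤ.+ + (toℕ i * N) ℤ.- ρ (proj₁ k))) j*N≡)
               (difference x (ρ (proj₁ k)) (+ (toℕ i * N)) (+ (suc d * N))))

  unshift : ∀ {m} x n j {N} → m ∣ N → Hit (x ℤ.+ + (j * N)) (n , m) → Hit x (n , m)
  unshift x n j {N} m∣N hit = ∣-combine hit (ℤ.∣m⇒∣-m (pos-∣ (∣n⇒∣m*n j m∣N))) (cancel x (+ (j * N)) (ρ n))
    where
    cancel : ∀ x a r → (x ℤ.+ a ℤ.- r) ℤ.+ ℤ.- a ≡ x ℤ.- r
    cancel = solveℤ

  module _ {L} (cov : Covers L) (N : ℕ) where

    translates-in-rest : ∀ x → ¬ Any (Hit x) (kept N L) → ∀ j → Any (Hit (x ℤ.+ + (j * N))) (rest N L)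
    translates-in-rest x ¬kept j with find (cov (x ℤ.+ + (j * N)))
    ... | k , k∈L , hit with proj₂ k ∣? N
    ...   | yes m∣N = contradiction
      (lose (∈-filter⁺ (λ k → proj₂ k ∣? N) k∈L m∣N) (unshift x (proj₁ k) j m∣N hit)) ¬kept
    ...   | no  m∤N = lose (∈-filter⁺ (λ k → ¬? (proj₂ k ∣? N)) k∈L m∤N) hit

    drop-rest : ∀ {p} → Droppable p N L → Covers (kept N L)
    drop-rest {p} (few , sep) x with Any.any? (hit? x) (kept N L)
    ... | yes hit  = hit
    ... | no  miss = contradiction (fibre-bound p N x sep (translates-in-rest x miss ∘ toℕ)) (<⇒≱ few)

    module _ (p : ℕ) (few : length (rest N L) ≤ p) (sep : All (Separated p N) (rest N L))
             (e : Key → ℕ) (divisors : All (λ k → e k ∣ proj₂ k × e k ∣ N) (rest N L)) where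

      reduced? : ∀ x k → Dec (Hit x (proj₁ k , e k))
      reduced? x k = hit? x (proj₁ k , e k)

      -- If `x` misses the reduced class of some `k`, then so do its translates, since `e k ∣ N`,
      -- and none lies in the class of `k`. Fewer than `p` classes are left to hold `p` translates.
      merge-rest : ∀ x → Any (Hit x) (kept N L) ⊎ All (λ k → Hit x (proj₁ k , e k)) (rest N L)
      merge-rest x with Any.any? (hit? x) (kept N L) | All.all? (reduced? x) (rest N L)
      ... | yes hit  | _       = inj₁ hit
      ... | no  _    | yes all = inj₂ all
      ... | no  miss | no ¬all = contradiction
        (fibre-bound p N x (All.filter⁺ (reduced? x) sep) narrowed)
        (<⇒≱ (<-≤-trans (filter-notAll (reduced? x) _ (¬All⇒Any¬ (reduced? x) _ ¬all)) few))
        where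
        narrowed : ∀ (j : Fin p) → Any (Hit (x ℤ.+ + (toℕ j * N))) (filter (reduced? x) (rest N L))
        narrowed j with find (translates-in-rest x miss (toℕ j))
        ... | k , k∈ , hit with All.lookup divisors k∈
        ...   | e∣m , e∣N = lose (∈-filter⁺ (reduced? x) k∈
                (unshift x (proj₁ k) (toℕ j) e∣N (ℤ.∣-trans (pos-∣ e∣m) hit))) hit

  sieve-covers : ∀ ps {N L} → Sievable ps N L → Covers L → Covers (sieve ps N L)
  sieve-covers []       _            cov = cov
  sieve-covers (p ∷ ps) (drop , more) cov = sieve-covers ps more (drop-rest cov _ drop)

-- From the moduli up to 59 to divisors of 360

primes : List ℕ
primes = 59 ∷ 53 ∷ 47 ∷ 43 ∷ 41 ∷ 37 ∷ 31 ∷ 29 ∷ 23 ∷ 19 ∷ 17 ∷ 13 ∷ 11 ∷ 7 ∷ 5 ∷ 3 ∷ 2 ∷ []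

diagonal : List ℕ → List Key
diagonal = map (λ n → n , n)

allKeys sieved merged reduced : List Key
allKeys = applyUpTo (λ i → 4 + i , 4 + i) 56
sieved  = diagonal (4 ∷ 5 ∷ 6 ∷ 7 ∷ 8 ∷ 9 ∷ 10 ∷ 12 ∷ 14 ∷ 15 ∷ 16 ∷ 18 ∷ 20 ∷ 21 ∷ 24 ∷ 28 ∷ 30 ∷ 35 ∷ 36
                    ∷ 40 ∷ 42 ∷ 45 ∷ 48 ∷ 56 ∷ [])
merged  = diagonal (120 ∷ 4 ∷ 5 ∷ 6 ∷ 8 ∷ 9 ∷ 10 ∷ 12 ∷ 15 ∷ 16 ∷ 18 ∷ 20 ∷ 24 ∷ 30 ∷ 36 ∷ 40 ∷ 45 ∷ 48 ∷ [])
reduced = (pinned ++ free) ++ map (map₂ (5 *_)) fivefold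

-- The product of `primes` and 5040 is a multiple of all moduli: besides the larger primes, only 32,
-- 27, 25, 49 and multiples of them require a factor beyond 5040. Each prime removes fewer moduli
-- than its size, such as five for 11 and two for 3.
sievable : Sievable primes 5040 allKeys
sievable = from-yes (sievable? primes 5040 allKeys)

sieve-primes : sieve primes 5040 allKeys ≡ sieved
sieve-primes = from-yes (List.≡-dec (≡-dec _≟_ _≟_) (sieve primes 5040 allKeys) sieved)

Divisors : ℕ → (p : ℕ) .{{_ : NonZero p}} → Key → Set
Divisors N p k = proj₂ k / p ∣ proj₂ k × proj₂ k / p ∣ N

divisors? : ∀ N p .{{_ : NonZero p}} k → Dec (Divisors N p k)
divisors? N p k = (proj₂ k / p ∣? proj₂ k) ×-dec (proj₂ k / p ∣? N)

sevens-separated : All (Separated 7 720) (rest 720 sieved)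
sevens-separated = from-yes (All.all? (separated? 7 720) (rest 720 sieved))

sevens-divisors : All (Divisors 720 7) (rest 720 sieved)
sevens-divisors = from-yes (All.all? (divisors? 720 7) (rest 720 sieved))

sixteens-separated : All (Separated 2 360) (rest 360 merged)
sixteens-separated = from-yes (All.all? (separated? 2 360) (rest 360 merged))

sixteens-divisors : All (Divisors 360 2) (rest 360 merged)
sixteens-divisors = from-yes (All.all? (divisors? 360 2) (rest 360 merged))

kept-reduced : All (_∈ reduced) (kept 360 merged)
kept-reduced = from-yes (All.all? (_∈? reduced) (kept 360 merged))

module Reduce (ρ : ℕ → ℤ) (ρ-120 : ρ 120 ≡ + 40 ℤ.* ρ 21 ℤ.+ (ℤ.- + 15 ℤ.* ρ 56 ℤ.+ ℤ.- + 24 ℤ.* ρ 35)) where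

  open Covering ρ

  merge-sevens : Covers sieved → Covers merged
  merge-sevens cov x = [ there , here ∘ combined ]′
    (merge-rest cov 720 7 ≤-refl sevens-separated (λ k → proj₂ k / 7) sevens-divisors x)
    where
    affine : ∀ u v w x a b c → u ℤ.* (x ℤ.- a) ℤ.+ (v ℤ.* (x ℤ.- b) ℤ.+ w ℤ.* (x ℤ.- c)) ≡
      (u ℤ.+ (v ℤ.+ w)) ℤ.* x ℤ.- (u ℤ.* a ℤ.+ (v ℤ.* b ℤ.+ w ℤ.* c))
    affine = solveℤ

    120∣-120 : + 120 ℤ.∣ ℤ.- + 120
    120∣-120 = ℤ.∣m⇒∣-m ℤ.∣-refl

    combined : All (λ k → Hit x (proj₁ k , proj₂ k / 7)) (rest 720 sieved) → Hit x (120 , 120)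
    -- The entries belong to 7, 14, 21, 28, 35, 42, 56. Those of 21, 35 and 56 are reduced to the
    -- pairwise coprime moduli 3, 5 and 8.
    combined (_ ∷ _ ∷ hit₂₁ ∷ _ ∷ hit₃₅ ∷ _ ∷ hit₅₆ ∷ []) =
      ∣-combine {+ 120} (ℤ.*-monoʳ-∣ (+ 40) hit₂₁)
        (ℤ.∣m∣n⇒∣m+n (ℤ.∣-trans 120∣-120 (ℤ.*-monoʳ-∣ (ℤ.- + 15) hit₅₆))
                      (ℤ.∣-trans 120∣-120 (ℤ.*-monoʳ-∣ (ℤ.- + 24) hit₃₅)))
        (trans (affine (+ 40) (ℤ.- + 15) (ℤ.- + 24) x (ρ 21) (ρ 56) (ρ 35))
               (cong₂ ℤ._-_ (ℤ.*-identityˡ x) (sym ρ-120)))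

  merge-sixteens : Covers merged → Covers reduced
  merge-sixteens cov x = [ relist , combined ]′
    (merge-rest cov 360 2 ≤-refl sixteens-separated (λ k → proj₂ k / 2) sixteens-divisors x)
    where
    relist : Any (Hit x) (kept 360 merged) → Any (Hit x) reduced
    relist hit = let k , k∈ , h = find hit in lose (All.lookup kept-reduced k∈) h

    combined : All (λ k → Hit x (proj₁ k , proj₂ k / 2)) (rest 360 merged) → Any (Hit x) reduced
    combined (_ ∷ hit₄₈ ∷ []) = lose (from-yes ((48 , 24) ∈? reduced)) hit₄₈

  reduce : Covers allKeys → Covers reduced
  reduce cov = merge-sixteens (merge-sevens (subst Covers sieve-primes
    (sieve-covers primes {5040} {allKeys} sievable cov)))

-- Passage to the five fibres over ℤ/72

open Covering using (Covers)

period∣modulus : ∀ k → period k ∣ proj₂ k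
period∣modulus (_ , zero)  = divides 0 refl
period∣modulus (_ , suc m) = ∣-refl

coprime-∣72 : All (λ k → proj₂ k ∣ 72) (pinned ++ free)
coprime-∣72 = from-yes (All.all? (λ k → proj₂ k ∣? 72) (pinned ++ free))

fivefold-∣72 : All (λ k → proj₂ k ∣ 72) fivefold
fivefold-∣72 = from-yes (All.all? (λ k → proj₂ k ∣? 72) fivefold)

module Fibration (ρ : ℕ → ℤ) (cov : Covers ρ reduced) (8∣ρ8 : + 8 ℤ.∣ ρ 8) (9∣ρ9 : + 9 ℤ.∣ ρ 9) where

  open Covering ρ using (Hit; unshift)
  open Residues (λ k → ρ (proj₁ k) %ℕ period k) (λ k → n%ℕd<d (ρ (proj₁ k)) (period k)) (λ k → ρ (proj₁ k) %ℕ 5)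

  hit⇒hits : ∀ y k → Hit (+ y) k → Hits y k
  hit⇒hits y k hit = %ℕ-cong (period k) (+ y) (ρ (proj₁ k)) (ℤ.∣-trans (pos-∣ (period∣modulus k)) hit)

  -- Congruent to y modulo 72 and to j modulo 5.
  point : ℕ → ℕ → ℕ
  point y j = y + (2 * y + 3 * j) * 72

  -- From 1 + 2 · 72 = 29 · 5 and 3 · 72 = 1 + 43 · 5.
  point-mod-5 : ∀ y j → y + (2 * y + 3 * j) * 72 ≡ j + (29 * y + 43 * j) * 5
  point-mod-5 = solve-∀

  project : ∀ y j n {m} → m ∣ 72 → Hit (+ point y j) (n , m) → Hit (+ y) (n , m)
  project y j n m∣72 = unshift (+ y) n (2 * y + 3 * j) m∣72

  fibre : ∀ y j n → j < 5 → Hit (+ point y j) (n , 5) → ρ n %ℕ 5 ≡ j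
  fibre y j n j<5 hit = trans (sym (%ℕ-cong 5 (+ j) (ρ n)
      (unshift (+ j) n (29 * y + 43 * j) ∣-refl (subst (λ x → Hit (+ x) (n , 5)) (point-mod-5 y j) hit))))
    (m<n⇒m%n≡m j<5)

  -- A class modulo 5b containing `point y j` gives a condition modulo b on `y` and determines `j`;
  -- a modulus dividing 72 sees only `y`.
  hits-point : ∀ y j → j < 5 → Any (Hits y) (pinned ++ free) ⊎ Any (Hits y) (group j fivefold)
  hits-point y j j<5 with Any.++⁻ (pinned ++ free) (cov (+ point y j))
  ... | inj₁ hit with find hit
  ...   | k , k∈ , h = inj₁ (lose k∈ (hit⇒hits y k (project y j (proj₁ k) (All.lookup coprime-∣72 k∈) h)))
  hits-point y j j<5 | inj₂ hit with find (Any.map⁻ {f = map₂ (5 *_)} hit)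
  ...   | k , k∈ , h = inj₂ (lose
    (∈-filter⁺ (λ k → ρ (proj₁ k) %ℕ 5 ≟ j) k∈
      (fibre y j (proj₁ k) j<5 (ℤ.∣-trans (pos-∣ (∣m⇒∣m*n (proj₂ k) ∣-refl)) h)))
    (hit⇒hits y k (project y j (proj₁ k) (All.lookup fivefold-∣72 k∈) (ℤ.∣-trans (pos-∣ (∣n⇒∣m*n 5 ∣-refl)) h))))

  fibred : Fibred free points
  fibred {u} u∈ j j<5 = Sum.map₁ unpinned (hits-point u j j<5)
    where
    u∈₈ = sift-∈ (8 , 8) u∈
    u∈₉ = sift-∈ (9 , 9) {U = upTo 72 ++ applyUpTo (3 *_) 24} (proj₁ u∈₈)

    residue-0 : ∀ d .{{_ : NonZero d}} r → + d ℤ.∣ r → r %ℕ d ≡ 0ℤ %ℕ d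
    residue-0 d r d∣r = %ℕ-cong d r 0ℤ (subst (+ d ℤ.∣_) (sym (ℤ.+-identityʳ r)) d∣r)

    unpinned : Any (Hits u) (pinned ++ free) → Any (Hits u) free
    unpinned (here h)            = contradiction (trans h (residue-0 8 (ρ 8) 8∣ρ8)) (proj₂ u∈₈)
    unpinned (there (here h))    = contradiction (trans h (residue-0 9 (ρ 9) 9∣ρ9)) (proj₂ u∈₉)
    unpinned (there (there hit)) = hit

  absurd : ⊥
  absurd = not-fibred fibred

not-centred : ∀ ρ → + 8 ℤ.∣ ρ 8 → + 9 ℤ.∣ ρ 9 → ¬ Covers ρ reduced
not-centred ρ 8∣ρ8 9∣ρ9 cov = Fibration.absurd ρ cov 8∣ρ8 9∣ρ9

translate : ∀ ρ τ {L} → Covers ρ L → Covers (λ n → ρ n ℤ.- τ) L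
translate ρ τ cov x = Any.map (λ {k} → subst (+ proj₂ k ℤ.∣_) (shift x τ (ρ (proj₁ k)))) (cov (x ℤ.+ τ))
  where
  shift : ∀ x t r → x ℤ.+ t ℤ.- r ≡ x ℤ.- (r ℤ.- t)
  shift = solveℤ

not-reduced : ∀ ρ → ¬ Covers ρ reduced
not-reduced ρ cov = not-centred (λ n → ρ n ℤ.- τ)
  (near (+ 225) (+ 280) (ρ 8) (ρ 9) (ℤ.divides (+ 28) refl) (ℤ.divides (+ 35) refl))
  (subst (λ t → + 9 ℤ.∣ ρ 9 ℤ.- t) (ℤ.+-comm (+ 280 ℤ.* ρ 9) (+ 225 ℤ.* ρ 8))
    (near (+ 280) (+ 225) (ρ 9) (ρ 8) (ℤ.divides (+ 31) refl) (ℤ.divides (+ 25) refl)))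
  (translate ρ τ cov)
  where
  τ : ℤ
  -- Chinese remainders: 225 is 1 modulo 8 and 0 modulo 9, 280 the reverse, so `τ` agrees with `ρ 8`
  -- modulo 8 and with `ρ 9` modulo 9.
  τ = + 225 ℤ.* ρ 8 ℤ.+ + 280 ℤ.* ρ 9

  near : ∀ {d} u v a b → d ℤ.∣ u ℤ.- + 1 → d ℤ.∣ v → d ℤ.∣ a ℤ.- (u ℤ.* a ℤ.+ v ℤ.* b)
  near u v a b d∣u-1 d∣v = ∣-combine (ℤ.∣n⇒∣m*n (ℤ.- a) d∣u-1) (ℤ.∣n⇒∣m*n (ℤ.- b) d∣v) (rearrange u v a b)
    where
    rearrange : ∀ u v a b → ℤ.- a ℤ.* (u ℤ.- + 1) ℤ.+ ℤ.- b ℤ.* v ≡ a ℤ.- (u ℤ.* a ℤ.+ v ℤ.* b)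
    rearrange = solveℤ

-- The residue function of a distinct covering

residueAt : List Congruence → ℕ → ℤ
-- A modulus absent from the covering gets residue 0; an additional class keeps a covering a
-- covering.
residueAt []       n = 0ℤ
residueAt (c ∷ cs) n with modulus c ≟ n
... | yes _ = residue c
... | no  _ = residueAt cs n

residueAt-∈ : ∀ {cs c} → Unique (map modulus cs) → c ∈ cs → residueAt cs (modulus c) ≡ residue c
residueAt-∈ {c ∷ _} _ (here refl) with modulus c ≟ modulus c
... | yes _   = refl
... | no  c≢c = contradiction refl c≢c
residueAt-∈ {c′ ∷ _} {c} (c′∉ ∷ uniq) (there c∈) with modulus c′ ≟ modulus c
... | yes c′≡c = contradiction c′≡c (All.lookup c′∉ (∈-map⁺ modulus c∈))
... | no  _    = residueAt-∈ uniq c∈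

-- A Bézout combination: 40 - 15 - 24 = 1 and 40 · 3 = 15 · 8 = 24 · 5 = 120.
extend : (ℕ → ℤ) → ℕ → ℤ
extend ρ n = if n ≡ᵇ 120 then + 40 ℤ.* ρ 21 ℤ.+ (ℤ.- + 15 ℤ.* ρ 56 ℤ.+ ℤ.- + 24 ℤ.* ρ 35) else ρ n

extend-small : ∀ ρ {n} → n ≤ 59 → extend ρ n ≡ ρ n
extend-small ρ {n} n≤59 with n ≡ᵇ 120 in eq
... | false = refl
... | true  = contradiction (subst (_≤ 59) (≡ᵇ⇒≡ n 120 (subst T (sym eq) tt)) n≤59) (<⇒≱ (from-yes (59 <? 120)))

∈-allKeys : ∀ {m} → 4 ≤ m → m ≤ 59 → (m , m) ∈ allKeys
∈-allKeys {m} 4≤m m≤59 = subst (λ n → (n , n) ∈ allKeys) (m+[n∸m]≡n 4≤m)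
  (∈-applyUpTo⁺ (λ i → 4 + i , 4 + i) (s≤s (∸-monoˡ-≤ 4 m≤59)))

no-distinct-covering-in-4-59 : ¬ HasDistinctCoveringIn 4 59
no-distinct-covering-in-4-59 (cs , (cov , uniq , _) , bounds) = not-reduced ρ (Reduce.reduce ρ refl covers)
  where
  ρ : ℕ → ℤ
  ρ = extend (residueAt cs)

  covers : Covers ρ allKeys
  covers x with cov x
  ... | c , c∈ , sat with All.lookup bounds c∈
  ...   | 4≤m , m≤59 = lose (∈-allKeys 4≤m m≤59)
    (subst (λ r → + modulus c ℤ.∣ x ℤ.- r)
      (sym (trans (extend-small (residueAt cs) m≤59) (residueAt-∈ uniq c∈))) (ℤ.∣ᵤ⇒∣ sat))

theorem2 : HasDistinctCoveringIn 4 60 × ¬ HasDistinctCoveringIn 4 59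
theorem2 = distinct-covering-in-4-60 , no-distinct-covering-in-4-59
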